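{- Let $m_1 \leq m_2 \leq m_3$ be three natural numbers. Then: (1) $box(TCC(m_1))=cub(TCC(m_1))=0$; (2) $box(TCC(m_1,m_2))=cub(TCC(m_1,m_2))=m_1$; (3) $box(TCC(m_1,m_2,m_3))=cub(TCC(m_1,m_2,m_3))=m_1+m_2$.
   Context: Natural numbers here are positive integers. All graphs are finite, simple and undirected. Boxicity and cubicity: a $k$-box (resp. $k$-cube) is a Cartesian product of $k$ closed intervals (resp. closed unit-length intervals) of $\mathbb{R}$. A $k$-box (resp. $k$-cube) representation of a graph $\Gamma$ is a function $f$ assigning to each vertex a $k$-box (resp. $k$-cube) such that two distinct vertices $u,v$ are adjacent if and only if $f(u)\cap f(v)\neq\emptyset$. The boxicity $box(\Gamma)$ (resp. cubicity $cub(\Gamma)$) is the smallest non-negative integer $k$ for which $\Gamma$ has a $k$-box (resp. $k$-cube) representation; complete graphs have boxicity and cubicity $0$. For positive integers $a_1,\dots,a_s$, $TCC(a_1,\dots,a_s)$ (the transitive closure of the Cartesian product of the complete graphs $K_{a_1+1},\dots,K_{a_s+1}$) is the graph whose vertices are the integer $s$-tuples $x=(x_1,\dots,x_s)$ with $0\leq x_i\leq a_i$ for all $i$, where two distinct vertices $x,y$ are adjacent if and only if either $x_i\leq y_i$ for all $i$, or $x_i\geq y_i$ for all $i$. -}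

module Defs where

open import Data.Fin using (Fin; toℕ)
open import Data.Fin.Properties using (1↔⊤; *↔×)
open import Data.Nat as ℕ using (ℕ; suc)
open import Data.Product using (Σ; ∃; _×_; _,_; proj₁; uncurry)
open import Data.Product.Function.NonDependent.Propositional using (_×-↔_)
open import Data.Rational using (ℚ; _+_; _-_; -_; _<_; 1ℚ)
import Data.Rational.Properties as ℚ
open import Data.Sum using (_⊎_; swap)
open import Data.Unit using (tt)
open import Data.Vec using (Vec; []; _∷_)
open import Data.Vec.Relation.Binary.Pointwise.Inductive using (Pointwise)
open import Data.Vec.Relation.Unary.All using (All; []; _∷_; reduce; uncons)
open import Function using (_∘_)
open import Function.Bundles using (_⇔_; _↔_; mk⇔; mk↔ₛ′; module Equivalence)
open import Function.Construct.Composition using (_↔-∘_)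
open import Function.Construct.Identity using (↔-id)
open import Function.Properties.Inverse using (↔-sym)
open import Relation.Binary.Definitions using (Symmetric; Irreflexive)
open import Relation.Binary.PropositionalEquality
  using (_≡_; _≢_; refl; sym; trans; cong; subst; ≢-sym)
open import Relation.Nullary using (¬_)

------------------------------------------------------------------------
-- Real numbers, as two-sided Dedekind cuts of ℚ

record ℝ : Set₁ where
  field
    Lower Upper    : ℚ → Set
    lower-nonempty : ∃ Lower
    upper-nonempty : ∃ Upper
    lower-rounded  : ∀ q → Lower q ⇔ (∃ λ r → q < r × Lower r)
    upper-rounded  : ∀ q → Upper q ⇔ (∃ λ r → r < q × Upper r)
    disjoint       : ∀ q → Lower q → ¬ Upper q
    located        : ∀ q r → q < r → Lower q ⊎ Upper r

open ℝ

infix 4 _≤ᵣ_ _≃ᵣ_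

_≤ᵣ_ : ℝ → ℝ → Set
x ≤ᵣ y = ∀ q → Lower x q → Lower y q

_≃ᵣ_ : ℝ → ℝ → Set
x ≃ᵣ y = x ≤ᵣ y × y ≤ᵣ x

private
  cancel : ∀ q t → (q + t) - t ≡ q
  cancel q t = trans (ℚ.+-assoc q t (- t))
    (trans (cong (q +_) (ℚ.+-inverseʳ t)) (ℚ.+-identityʳ q))

  cancel′ : ∀ q t → (q - t) + t ≡ q
  cancel′ q t = trans (ℚ.+-assoc q (- t) t)
    (trans (cong (q +_) (ℚ.+-inverseˡ t)) (ℚ.+-identityʳ q))

infixl 6 _⊕_

-- Adding a rational t to a real x: a cut is translated by t.
_⊕_ : ℝ → ℚ → ℝ
x ⊕ t = record
  { Lower          = λ q → Lower x (q - t)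
  ; Upper          = λ q → Upper x (q - t)
  ; lower-nonempty = nonempty (Lower x) (lower-nonempty x)
  ; upper-nonempty = nonempty (Upper x) (upper-nonempty x)
  ; lower-rounded  = λ q → mk⇔
      (λ l → let r , q-t<r , l′ = to (lower-rounded x (q - t)) l in
        r + t
        , subst (_< r + t) (cancel′ q t) (ℚ.+-monoˡ-< t q-t<r)
        , subst (Lower x) (sym (cancel r t)) l′)
      (λ (r , q<r , l) → from (lower-rounded x (q - t))
        (r - t , ℚ.+-monoˡ-< (- t) q<r , l))
  ; upper-rounded  = λ q → mk⇔
      (λ u → let r , r<q-t , u′ = to (upper-rounded x (q - t)) u in
        r + t
        , subst (r + t <_) (cancel′ q t) (ℚ.+-monoˡ-< t r<q-t)
        , subst (Upper x) (sym (cancel r t)) u′)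
      (λ (r , r<q , u) → from (upper-rounded x (q - t))
        (r - t , ℚ.+-monoˡ-< (- t) r<q , u))
  ; disjoint       = λ q → disjoint x (q - t)
  ; located        = λ q r q<r → located x (q - t) (r - t) (ℚ.+-monoˡ-< (- t) q<r)
  }
  where
  open Equivalence
  nonempty : (P : ℚ → Set) → ∃ P → ∃ λ q → P (q - t)
  nonempty P (q , p) = q + t , subst P (sym (cancel q t)) p

------------------------------------------------------------------------
-- Boxes and cubes

record Interval : Set₁ where
  field
    lo hi : ℝ
    lo≤hi : lo ≤ᵣ hi

open Interval

HasUnitLength : Interval → Set
HasUnitLength I = hi I ≃ᵣ lo I ⊕ 1ℚ

Box : ℕ → Set₁
Box k = Fin k → Interval

Cube : ℕ → Set₁
Cube k = Σ (Box k) λ B → ∀ i → HasUnitLength (B i)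

infix 4 _∈ᵇ_

_∈ᵇ_ : ∀ {k} → (Fin k → ℝ) → Box k → Set
p ∈ᵇ B = ∀ i → lo (B i) ≤ᵣ p i × p i ≤ᵣ hi (B i)

Intersect : ∀ {k} → Box k → Box k → Set₁
Intersect B C = ∃ λ p → p ∈ᵇ B × p ∈ᵇ C

------------------------------------------------------------------------
-- Finite simple graphs, boxicity and cubicity

record Graph : Set₁ where
  field
    Vertex : Set
    finite : ∃ λ n → Vertex ↔ Fin n
    Adj    : Vertex → Vertex → Set
    symm   : Symmetric Adj
    irrefl : Irreflexive _≡_ Adj

open Graph

IsBoxRep : (Γ : Graph) {k : ℕ} → (Vertex Γ → Box k) → Set₁
IsBoxRep Γ f = ∀ u v → u ≢ v → Adj Γ u v ⇔ Intersect (f u) (f v)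

HasBoxRep : Graph → ℕ → Set₁
HasBoxRep Γ k = Σ (Vertex Γ → Box k) λ f → IsBoxRep Γ f

HasCubeRep : Graph → ℕ → Set₁
HasCubeRep Γ k = Σ (Vertex Γ → Cube k) λ f → IsBoxRep Γ (proj₁ ∘ f)

IsLeast : (ℕ → Set₁) → ℕ → Set₁
IsLeast P n = P n × (∀ k → P k → n ℕ.≤ k)

-- box(Γ) = n and cub(Γ) = n, as relations: a minimum over ℕ need not be
-- computable.
IsBoxicity IsCubicity : Graph → ℕ → Set₁
IsBoxicity Γ = IsLeast (HasBoxRep Γ)
IsCubicity Γ = IsLeast (HasCubeRep Γ)

------------------------------------------------------------------------
-- The graph TCC(a₁,…,aₛ)

-- Tuples x with 0 ≤ xᵢ ≤ aᵢ, the i-th entry being stored in Fin (suc aᵢ)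
-- so that distinctness of tuples is just _≢_.
Tuple : ∀ {s} → Vec ℕ s → Set
Tuple = All (Fin ∘ suc)

coords : ∀ {s} {a : Vec ℕ s} → Tuple a → Vec ℕ s
coords = reduce toℕ

infix 4 _≼_

_≼_ : ∀ {s} {a : Vec ℕ s} → Tuple a → Tuple a → Set
x ≼ y = Pointwise ℕ._≤_ (coords x) (coords y)

Tuple-finite : ∀ {s} (a : Vec ℕ s) → ∃ λ n → Tuple a ↔ Fin n
Tuple-finite []      = 1 , ↔-sym 1↔⊤ ↔-∘ mk↔ₛ′ (λ _ → tt) (λ _ → [])
  (λ _ → refl) (λ { [] → refl })
Tuple-finite (a ∷ as) =
  let n , as↔n = Tuple-finite as in
  suc a ℕ.* n ,
  ↔-sym *↔× ↔-∘ ((↔-id _ ×-↔ as↔n) ↔-∘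
    mk↔ₛ′ uncons (uncurry _∷_) (λ _ → refl) (λ { (_ ∷ _) → refl }))

TCC : ∀ {s} → Vec ℕ s → Graph
TCC a = record
  { Vertex = Tuple a
  ; finite = Tuple-finite a
  ; Adj    = λ x y → x ≢ y × (x ≼ y ⊎ y ≼ x)
  ; symm   = λ (x≢y , c) → ≢-sym x≢y , swap c
  ; irrefl = λ { refl (x≢x , _) → x≢x refl }
  }

{-# OPTIONS --safe #-}
module Submission where

-- Upper bound.  A cut consists of a threshold i on one coordinate and a height;
-- its unit intervals keep x and y apart exactly when x is at most i, y is above i,
-- and x is higher than y.  In three dimensions the m₁ cuts of the first coordinate,
-- with the lexicographic height (x₂, x₃), and the m₂ cuts of the second one, with
-- height x₃, separate all incomparable pairs.
--
-- Lower bound.  Interval orders contain no 2+2, so when one set of vertices lies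
-- below another, no coordinate of a box representation separates a pair in each.
-- Along a chain of such blocks the required numbers of coordinates therefore add up.
-- A 2-element antichain needs one coordinate; the crown of atoms and coatoms of a
-- Boolean cube needs two.  With t = (m₁ + m₂) ∸ m₃, there is a chain of t cubes,
-- m₁ ∸ t antichains raising coordinates 1 and 3, and m₂ ∸ t antichains raising
-- coordinates 2 and 3; they need 2t + (m₁ ∸ t) + (m₂ ∸ t) = m₁ + m₂ coordinates.

open import Defs
open import Data.Fin using (Fin; zero; suc; toℕ; fromℕ<; combine; splitAt; _↑ˡ_; _↑ʳ_)
import Data.Fin.Properties as Fin
import Data.Integer as ℤ
open import Data.Nat using (ℕ; zero; suc; z≤n; s≤s; _+_; _*_; _∸_; _≤_; _<_)
open import Data.Nat.Coprimality using (1-coprimeTo)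
import Data.Nat.Properties as ℕ
open import Data.Nat.Solver using (module +-*-Solver)
open import Data.Product using (∃; _×_; _,_; proj₁; proj₂; swap)
import Data.Product as Product
open import Data.Rational as ℚ using (ℚ; mkℚ; 1ℚ; *≤*; *<*)
import Data.Rational.Properties as ℚ
open import Data.Sum as Sum using (_⊎_; inj₁; inj₂; [_,_]′)
open import Data.Vec using (Vec; []; _∷_)
open import Data.Vec.Relation.Binary.Pointwise.Inductive using ([]; _∷_)
import Data.Vec.Relation.Binary.Pointwise.Inductive as Pointwise
open import Data.Vec.Relation.Unary.All as All using (All; []; _∷_)
open import Data.Vec.Relation.Unary.AllPairs using ([]; _∷_)
open import Data.Vec.Relation.Unary.Unique.Propositional using (Unique)
open import Data.Vec.Relation.Unary.Unique.Propositional.Properties using (lookup-injective)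
open import Effect.Monad using (RawMonad)
open import Function using (_∘_; id)
open import Function.Bundles using (_⇔_; mk⇔; module Equivalence)
open import Function.Properties.Inverse using (↔⇒↣)
open import Level using (0ℓ)
open import Relation.Binary.Definitions using (tri<; tri≈; tri>; DecidableEquality)
open import Relation.Binary.PropositionalEquality as ≡ using (_≡_; _≢_; refl; cong; subst)
open import Relation.Nullary using (¬_; Dec; yes; no; contradiction)
open import Relation.Nullary.Decidable using (decidable-stable)
open import Relation.Nullary.Negation using (¬¬-Monad; ¬¬-map)

open Equivalence
open ℝ
open Interval
open Graph

-- Order on the reals

lower-closed : ∀ x {q r} → q ℚ.< r → Lower x r → Lower x q
lower-closed x q<r l = from (lower-rounded x _) (_ , q<r , l)

upper-closed : ∀ x {q r} → q ℚ.< r → Upper x q → Upper x r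
upper-closed x q<r u = from (upper-rounded x _) (_ , q<r , u)

upper-closed-≤ : ∀ x {q r} → q ℚ.≤ r → Upper x q → Upper x r
upper-closed-≤ x {q} {r} q≤r u with ℚ.<-cmp q r
... | tri< q<r _ _ = upper-closed x q<r u
... | tri≈ _ refl _ = u
... | tri> _ _ r<q = contradiction (ℚ.<-≤-trans r<q q≤r) (ℚ.<-irrefl refl)

lower<upper : ∀ x {q r} → Lower x q → Upper x r → q ℚ.< r
lower<upper x l u = ℚ.≰⇒> (λ r≤q → disjoint x _ l (upper-closed-≤ x r≤q u))

≤ᵣ-trans : ∀ x y z → x ≤ᵣ y → y ≤ᵣ z → x ≤ᵣ z
≤ᵣ-trans x y z x≤y y≤z q = y≤z q ∘ x≤y q

-- Locatedness replaces excluded middle: if some `r` in the lower cut of `y` were in the upper cut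
-- of `x`, all of `x` would lie below `r`, giving `x ≤ᵣ y`.
≰ᵣ⇒≥ᵣ : ∀ x y → ¬ x ≤ᵣ y → y ≤ᵣ x
≰ᵣ⇒≥ᵣ x y x≰y q lq with to (lower-rounded y q) lq
... | r , q<r , lr with located x q r q<r
...   | inj₁ l = l
...   | inj₂ u = contradiction
        (λ s ls → lower-closed y (lower<upper x ls u) lr) x≰y

-- The larger left end serves as the common point of two overlapping intervals; it is built as a cut
-- because `≤ᵣ` cannot be decided.
_⊔ᵣ_ : ℝ → ℝ → ℝ
x ⊔ᵣ y = record
  { Lower          = λ q → Lower x q ⊎ Lower y q
  ; Upper          = λ q → Upper x q × Upper y q
  ; lower-nonempty = Product.map₂ inj₁ (lower-nonempty x)
  ; upper-nonempty = let a , ua = upper-nonempty x ; b , ub = upper-nonempty y in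
      a ℚ.⊔ b , upper-closed-≤ x (ℚ.p≤p⊔q a b) ua , upper-closed-≤ y (ℚ.p≤q⊔p a b) ub
  ; lower-rounded  = λ q → mk⇔
      [ Product.map₂ (Product.map₂ inj₁) ∘ to (lower-rounded x q)
      , Product.map₂ (Product.map₂ inj₂) ∘ to (lower-rounded y q) ]′
      (λ (r , q<r , l) → Sum.map (lower-closed x q<r) (lower-closed y q<r) l)
  ; upper-rounded  = λ q → mk⇔ (round q)
      (λ (r , r<q , ux , uy) → upper-closed x r<q ux , upper-closed y r<q uy)
  ; disjoint       = λ q l (ux , uy) →
      [ (λ lx → disjoint x q lx ux) , (λ ly → disjoint y q ly uy) ]′ l
  ; located        = locate
  }
  where
  round : ∀ q → Upper x q × Upper y q → ∃ λ r → r ℚ.< q × Upper x r × Upper y r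
  round q (ux , uy) with to (upper-rounded x q) ux | to (upper-rounded y q) uy
  ... | r , r<q , ur | s , s<q , us with ℚ.≤-total r s
  ...   | inj₁ r≤s = s , s<q , upper-closed-≤ x r≤s ur , us
  ...   | inj₂ s≤r = r , r<q , ur , upper-closed-≤ y s≤r us

  locate : ∀ q r → q ℚ.< r → (Lower x q ⊎ Lower y q) ⊎ (Upper x r × Upper y r)
  locate q r q<r with located x q r q<r | located y q r q<r
  ... | inj₁ lx | _       = inj₁ (inj₁ lx)
  ... | inj₂ _  | inj₁ ly = inj₁ (inj₂ ly)
  ... | inj₂ ux | inj₂ uy = inj₂ (ux , uy)

real : ℚ → ℝ
real p = record
  { Lower          = ℚ._< p
  ; Upper          = p ℚ.<_
  ; lower-nonempty = p ℚ.- 1ℚ , subst (p ℚ.- 1ℚ ℚ.<_) (ℚ.+-identityʳ p) (ℚ.+-monoʳ-< p (ℚ.negative⁻¹ _))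
  ; upper-nonempty = p ℚ.+ 1ℚ , subst (ℚ._< p ℚ.+ 1ℚ) (ℚ.+-identityʳ p) (ℚ.+-monoʳ-< p (ℚ.positive⁻¹ _))
  ; lower-rounded  = λ q → mk⇔ ℚ.<-dense (λ (r , q<r , r<p) → ℚ.<-trans q<r r<p)
  ; upper-rounded  = λ q → mk⇔
      (λ p<q → let r , p<r , r<q = ℚ.<-dense p<q in r , r<q , p<r)
      (λ (r , r<q , p<r) → ℚ.<-trans p<r r<q)
  ; disjoint       = λ q → ℚ.<-asym
  ; located        = locate
  }
  where
  locate : ∀ q r → q ℚ.< r → q ℚ.< p ⊎ p ℚ.< r
  locate q r q<r with q ℚ.<? p
  ... | yes q<p = inj₁ q<p
  ... | no  q≮p = inj₂ (ℚ.≤-<-trans (ℚ.≮⇒≥ q≮p) q<r)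

p+q-q≡p : ∀ p q → p ℚ.+ q ℚ.- q ≡ p
p+q-q≡p p q = ≡.trans (ℚ.+-assoc p q (ℚ.- q))
  (≡.trans (cong (p ℚ.+_) (ℚ.+-inverseʳ q)) (ℚ.+-identityʳ p))

real-≤-⊕ : ∀ p q t → p ℚ.≤ q ℚ.+ t ⇔ real p ≤ᵣ real q ⊕ t
real-≤-⊕ p q t = mk⇔
  (λ p≤q+t r r<p → subst (r ℚ.- t ℚ.<_) (p+q-q≡p q t)
    (ℚ.+-monoˡ-< (ℚ.- t) (ℚ.<-≤-trans r<p p≤q+t)))
  -- Otherwise `q + t` lies in the lower cut of `real p`, and the inclusion puts `q` strictly below
  -- itself.
  (λ p≤q⊕t → ℚ.≮⇒≥ (λ q+t<p →
    ℚ.<-irrefl (p+q-q≡p q t) (p≤q⊕t (q ℚ.+ t) q+t<p)))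

-- Intersection of boxes

Overlap : Interval → Interval → Set
Overlap I J = lo I ≤ᵣ hi J × lo J ≤ᵣ hi I

intersect⇔overlap : ∀ {k} (B C : Box k) → Intersect B C ⇔ (∀ i → Overlap (B i) (C i))
intersect⇔overlap B C = mk⇔
  (λ (p , p∈B , p∈C) i →
    ≤ᵣ-trans (lo (B i)) (p i) (hi (C i)) (proj₁ (p∈B i)) (proj₂ (p∈C i)) ,
    ≤ᵣ-trans (lo (C i)) (p i) (hi (B i)) (proj₁ (p∈C i)) (proj₂ (p∈B i)))
  (λ o → (λ i → lo (B i) ⊔ᵣ lo (C i)) ,
    (λ i → (λ q → inj₁) , λ q → [ lo≤hi (B i) q , proj₂ (o i) q ]′) ,
    (λ i → (λ q → inj₂) , λ q → [ proj₁ (o i) q , lo≤hi (C i) q ]′))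

infix 4 _⊲_

-- A negative form of `hi I < lo J`: refuting an overlap yields it directly.
_⊲_ : Interval → Interval → Set
I ⊲ J = ¬ lo J ≤ᵣ hi I

-- Otherwise `lo J ≤ hi I′ ≤ lo J′ ≤ hi I`, against `I ⊲ J`; the middle inequality comes from
-- `I′ ⊲ J′`.
no-2+2 : ∀ I J I′ J′ → I ⊲ J → I′ ⊲ J′ → Overlap I J′ → ¬ Overlap I′ J
no-2+2 I J I′ J′ I⊲J I′⊲J′ (_ , J′≤I) (_ , J≤I′) = I⊲J
  (≤ᵣ-trans (lo J) (hi I′) (hi I) J≤I′
    (≤ᵣ-trans (hi I′) (lo J′) (hi I) (≰ᵣ⇒≥ᵣ (lo J′) (hi I′) I′⊲J′) J′≤I))

-- Cube representations from cuts

unitInterval : ℚ → Interval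
unitInterval p = record
  { lo    = real p
  ; hi    = real p ⊕ 1ℚ
  ; lo≤hi = to (real-≤-⊕ p p 1ℚ) (subst (ℚ._≤ p ℚ.+ 1ℚ) (ℚ.+-identityʳ p)
      (ℚ.+-monoʳ-≤ p (ℚ.nonNegative⁻¹ 1ℚ)))
  }

Near : ℚ → ℚ → Set
Near p q = p ℚ.≤ q ℚ.+ 1ℚ × q ℚ.≤ p ℚ.+ 1ℚ

unitInterval-overlap : ∀ p q → Near p q ⇔ Overlap (unitInterval p) (unitInterval q)
unitInterval-overlap p q = mk⇔
  (Product.map (to (real-≤-⊕ p q 1ℚ)) (to (real-≤-⊕ q p 1ℚ)))
  (Product.map (from (real-≤-⊕ p q 1ℚ)) (from (real-≤-⊕ q p 1ℚ)))

-- An order-reversing embedding of ℕ into (0,1]: unbounded heights fit into one unit, and no two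
-- values differ by 1 or more.
1/[1+_] : ℕ → ℚ
1/[1+ n ] = mkℚ (ℤ.+ 1) n (1-coprimeTo (suc n))

1/[1+]-mono-≤ : ∀ {m n} → m ≤ n → 1/[1+ n ] ℚ.≤ 1/[1+ m ]
-- The cross products reduce to `suc m + 0` and `suc n + 0`.
1/[1+]-mono-≤ m≤n = *≤* (ℤ.+≤+ (ℕ.+-monoˡ-≤ 0 (s≤s m≤n)))

1/[1+]-mono-< : ∀ {m n} → m < n → 1/[1+ n ] ℚ.< 1/[1+ m ]
1/[1+]-mono-< m<n = *<* (ℤ.+<+ (ℕ.+-monoˡ-< 0 (s≤s m<n)))

1/[1+]-≤-1+ : ∀ m n → 1/[1+ m ] ℚ.≤ 1/[1+ n ] ℚ.+ 1ℚ
1/[1+]-≤-1+ m n = ℚ.≤-trans (1/[1+]-mono-≤ (z≤n {m}))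
  (subst (ℚ._≤ 1/[1+ n ] ℚ.+ 1ℚ) (ℚ.+-identityˡ 1ℚ)
    (ℚ.+-monoˡ-≤ 1ℚ (ℚ.nonNegative⁻¹ 1/[1+ n ])))

-- The left ends for a cut at threshold i: vertices of key κ ≤ i start in (0,1],
-- the others in (1,2], and in each group greater height means further left.
position : ℕ → ℕ → ℕ → ℚ
position i κ h with κ ℕ.≤? i
... | yes _ = 1/[1+ h ]
... | no  _ = 1/[1+ h ] ℚ.+ 1ℚ

-- Within a group the ends are less than 1 apart. Across the threshold `κ ≤ κ′` fixes which vertex
-- is on the left, and `h ≤ h′` keeps the distance at most 1.
position-near : ∀ i {κ κ′ h h′} → κ ≤ κ′ → h ≤ h′ →
  Near (position i κ h) (position i κ′ h′)
position-near i {κ} {κ′} {h} {h′} κ≤κ′ h≤h′ with κ ℕ.≤? i | κ′ ℕ.≤? i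
... | yes _ | yes _ = 1/[1+]-≤-1+ h h′ , 1/[1+]-≤-1+ h′ h
... | yes _ | no _ = ℚ.≤-trans (1/[1+]-≤-1+ h h′)
  (subst (ℚ._≤ 1/[1+ h′ ] ℚ.+ 1ℚ ℚ.+ 1ℚ) (ℚ.+-identityʳ _)
    (ℚ.+-monoʳ-≤ (1/[1+ h′ ] ℚ.+ 1ℚ) (ℚ.nonNegative⁻¹ 1ℚ)))
  , ℚ.+-monoˡ-≤ 1ℚ (1/[1+]-mono-≤ h≤h′)
... | no κ≰i | yes κ′≤i = contradiction (ℕ.≤-trans κ≤κ′ κ′≤i) κ≰i
... | no _ | no _ = ℚ.+-monoˡ-≤ 1ℚ (1/[1+]-≤-1+ h h′) , ℚ.+-monoˡ-≤ 1ℚ (1/[1+]-≤-1+ h′ h)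

-- Across the threshold the left ends are `1 + 1/(1 + h′) - 1/(1 + h)` apart, which exceeds 1.
position-far : ∀ i {κ κ′ h h′} → κ ≤ i → i < κ′ → h′ < h →
  ¬ Near (position i κ h) (position i κ′ h′)
position-far i {κ} {κ′} κ≤i i<κ′ h′<h (_ , q≤p+1) with κ ℕ.≤? i | κ′ ℕ.≤? i
... | no κ≰i | _ = κ≰i κ≤i
... | yes _ | yes κ′≤i = ℕ.<⇒≱ i<κ′ κ′≤i
... | yes _ | no _ =
  ℚ.<-irrefl refl (ℚ.<-≤-trans (ℚ.+-monoˡ-< 1ℚ (1/[1+]-mono-< h′<h)) q≤p+1)

module _ {s} {a : Vec ℕ s} where

  record Cut : Set where
    field
      threshold   : ℕ
      key height  : Tuple a → ℕ
      key-mono    : ∀ x y → x ≼ y → key x ≤ key y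
      height-mono : ∀ x y → x ≼ y → height x ≤ height y

  open Cut

  Separates : Cut → Tuple a → Tuple a → Set
  Separates C x y = key C x ≤ threshold C × threshold C < key C y × height C y < height C x

  cutPosition : Cut → Tuple a → ℚ
  cutPosition C x = position (threshold C) (key C x) (height C x)

  cuts⇒cubeRep : ∀ {k} (C : Fin k → Cut) →
    (∀ x y → ¬ x ≼ y → ¬ y ≼ x → ∃ λ i → Separates (C i) x y ⊎ Separates (C i) y x) →
    (∀ x y → Dec (x ≼ y)) → HasCubeRep (TCC a) k
  cuts⇒cubeRep {k} C separating _≼?_ =
    -- Unit length holds by definition of `unitInterval`.
    (λ x → f x , λ i → (λ q → id) , (λ q → id)) , λ x y x≢y → mk⇔
      (λ (_ , c) → from (intersect⇔overlap (f x) (f y))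
        (λ i → to (unitInterval-overlap _ _) ([ near x y i , swap ∘ near y x i ]′ c)))
      (λ fx∩fy → x≢y , comparable x y λ i → from (unitInterval-overlap _ _)
        (to (intersect⇔overlap (f x) (f y)) fx∩fy i))
    where
    f : Tuple a → Box k
    f x i = unitInterval (cutPosition (C i) x)

    near : ∀ x y i → x ≼ y → Near (cutPosition (C i) x) (cutPosition (C i) y)
    near x y i x≼y = position-near (threshold (C i)) (key-mono (C i) x y x≼y) (height-mono (C i) x y x≼y)

    far : ∀ x y i → Separates (C i) x y → ¬ Near (cutPosition (C i) x) (cutPosition (C i) y)
    far x y i (κx≤ , <κy , hy<hx) = position-far (threshold (C i)) κx≤ <κy hy<hx

    comparable : ∀ x y → (∀ i → Near (cutPosition (C i) x) (cutPosition (C i) y)) → x ≼ y ⊎ y ≼ x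
    comparable x y allNear with x ≼? y | y ≼? x
    ... | yes x≼y | _ = inj₁ x≼y
    ... | _ | yes y≼x = inj₂ y≼x
    ... | no x⋠y | no y⋠x with separating x y x⋠y y⋠x
    ...   | i , inj₁ sep = contradiction (allNear i) (far x y i sep)
    ...   | i , inj₂ sep = contradiction (swap (allNear i)) (far y x i sep)

-- Families of cuts for one, two and three coordinates.

≼-dec : ∀ {s} {a : Vec ℕ s} (x y : Tuple a) → Dec (x ≼ y)
≼-dec x y = Pointwise.decidable ℕ._≤?_ (coords x) (coords y)

cubeRep₁ : ∀ m₁ → HasCubeRep (TCC (m₁ ∷ [])) 0
cubeRep₁ m₁ = cuts⇒cubeRep (λ ()) separating ≼-dec
  where
  separating : (x y : Tuple (m₁ ∷ [])) → ¬ x ≼ y → ¬ y ≼ x → _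
  separating (x₁ ∷ []) (y₁ ∷ []) x⋠y y⋠x =
    contradiction (Fin.≤-total x₁ y₁) [ x⋠y ∘ (_∷ []) , y⋠x ∘ (_∷ []) ]′

threshold-between : ∀ {m} (x y : Fin (suc m)) → toℕ x < toℕ y →
  -- The threshold is `toℕ x` itself, which is below `m` because `y` is at most `m`.
  ∃ λ (i : Fin m) → toℕ x ≤ toℕ i × toℕ i < toℕ y
threshold-between {m} x y x<y = fromℕ< x<m ,
  ℕ.≤-reflexive (≡.sym (Fin.toℕ-fromℕ< x<m)) ,
  subst (_< toℕ y) (≡.sym (Fin.toℕ-fromℕ< x<m)) x<y
  where
  x<m : toℕ x < m
  x<m = ℕ.<-≤-trans x<y (Fin.toℕ≤pred[n] y)

-- Incomparable pairs differ in the first coordinate, and the tuple that is smaller there is larger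
-- in the second.
cubeRep₂ : ∀ m₁ m₂ → HasCubeRep (TCC (m₁ ∷ m₂ ∷ [])) m₁
cubeRep₂ m₁ m₂ = cuts⇒cubeRep cut separating ≼-dec
  where
  cut : Fin m₁ → Cut
  cut i = record
    { threshold   = toℕ i
    ; key         = λ { (x₁ ∷ _) → toℕ x₁ }
    ; height      = λ { (_ ∷ x₂ ∷ []) → toℕ x₂ }
    ; key-mono    = λ { (_ ∷ _) (_ ∷ _) (x₁≤y₁ ∷ _) → x₁≤y₁ }
    ; height-mono = λ { (_ ∷ _ ∷ []) (_ ∷ _ ∷ []) (_ ∷ x₂≤y₂ ∷ []) → x₂≤y₂ }
    }

  cut-separates : ∀ x y → ¬ x ≼ y → toℕ (All.head x) < toℕ (All.head y) →
    ∃ λ i → Separates (cut i) x y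
  cut-separates (x₁ ∷ x₂ ∷ []) (y₁ ∷ y₂ ∷ []) x⋠y x₁<y₁ =
    let i , x₁≤i , i<y₁ = threshold-between x₁ y₁ x₁<y₁ in
    i , x₁≤i , i<y₁ , ℕ.≰⇒> (λ x₂≤y₂ → x⋠y (ℕ.<⇒≤ x₁<y₁ ∷ x₂≤y₂ ∷ []))

  separating : ∀ x y → ¬ x ≼ y → ¬ y ≼ x → ∃ λ i → Separates (cut i) x y ⊎ Separates (cut i) y x
  separating x@(x₁ ∷ x₂ ∷ []) y@(y₁ ∷ y₂ ∷ []) x⋠y y⋠x with ℕ.<-cmp (toℕ x₁) (toℕ y₁)
  ... | tri< x₁<y₁ _ _ = Product.map₂ inj₁ (cut-separates x y x⋠y x₁<y₁)
  ... | tri> _ _ y₁<x₁ = Product.map₂ inj₂ (cut-separates y x y⋠x y₁<x₁)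
  ... | tri≈ _ x₁≡y₁ _ = contradiction (Fin.≤-total x₂ y₂)
    [ (λ p → x⋠y (ℕ.≤-reflexive x₁≡y₁ ∷ p ∷ []))
    , (λ p → y⋠x (ℕ.≤-reflexive (≡.sym x₁≡y₁) ∷ p ∷ [])) ]′

combine-mono-≤ : ∀ {m n} {i j : Fin m} {k l : Fin n} → toℕ i ≤ toℕ j → toℕ k ≤ toℕ l →
  toℕ (combine i k) ≤ toℕ (combine j l)
combine-mono-≤ {m} {n} {i} {j} {k} {l} i≤j k≤l
  rewrite Fin.toℕ-combine i k | Fin.toℕ-combine j l = ℕ.+-mono-≤ (ℕ.*-monoʳ-≤ n i≤j) k≤l

combine-monoʳ-< : ∀ {m n} (i : Fin m) {k l : Fin n} → toℕ k < toℕ l →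
  toℕ (combine i k) < toℕ (combine i l)
combine-monoʳ-< {m} {n} i {k} {l} k<l
  rewrite Fin.toℕ-combine i k | Fin.toℕ-combine i l = ℕ.+-monoʳ-< (n * toℕ i) k<l

cubeRep₃ : ∀ m₁ m₂ m₃ → HasCubeRep (TCC (m₁ ∷ m₂ ∷ m₃ ∷ [])) (m₁ + m₂)
cubeRep₃ m₁ m₂ m₃ = cuts⇒cubeRep cut separating ≼-dec
  where
  -- The height is the lexicographic linear extension of the last two coordinates.
  cut₁ : Fin m₁ → Cut
  cut₁ i = record
    { threshold   = toℕ i
    ; key         = λ { (x₁ ∷ _) → toℕ x₁ }
    ; height      = λ { (_ ∷ x₂ ∷ x₃ ∷ []) → toℕ (combine x₂ x₃) }
    ; key-mono    = λ { (_ ∷ _) (_ ∷ _) (x₁≤y₁ ∷ _) → x₁≤y₁ }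
    ; height-mono = λ { (_ ∷ x₂ ∷ x₃ ∷ []) (_ ∷ y₂ ∷ y₃ ∷ []) (_ ∷ x₂≤y₂ ∷ x₃≤y₃ ∷ []) →
        combine-mono-≤ {i = x₂} {y₂} {x₃} {y₃} x₂≤y₂ x₃≤y₃ }
    }

  cut₂ : Fin m₂ → Cut
  cut₂ j = record
    { threshold   = toℕ j
    ; key         = λ { (_ ∷ x₂ ∷ _) → toℕ x₂ }
    ; height      = λ { (_ ∷ _ ∷ x₃ ∷ []) → toℕ x₃ }
    ; key-mono    = λ { (_ ∷ _ ∷ _) (_ ∷ _ ∷ _) (_ ∷ x₂≤y₂ ∷ _) → x₂≤y₂ }
    ; height-mono = λ { (_ ∷ _ ∷ _ ∷ []) (_ ∷ _ ∷ _ ∷ []) (_ ∷ _ ∷ x₃≤y₃ ∷ []) → x₃≤y₃ }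
    }

  cut : Fin (m₁ + m₂) → Cut
  cut = [ cut₁ , cut₂ ]′ ∘ splitAt m₁

  Separated : Tuple (m₁ ∷ m₂ ∷ m₃ ∷ []) → Tuple (m₁ ∷ m₂ ∷ m₃ ∷ []) → Set
  Separated x y = ∃ λ i → Separates (cut i) x y

  cut₁-separates : ∀ {x₁ x₂ x₃ y₁ y₂ y₃} → toℕ x₁ < toℕ y₁ → toℕ (combine y₂ y₃) < toℕ (combine x₂ x₃) →
    Separated (x₁ ∷ x₂ ∷ x₃ ∷ []) (y₁ ∷ y₂ ∷ y₃ ∷ [])
  cut₁-separates {x₁} {y₁ = y₁} x₁<y₁ y<x with threshold-between x₁ y₁ x₁<y₁
  ... | i , x₁≤i , i<y₁ = i ↑ˡ m₂ ,
    subst (λ c → Separates ([ cut₁ , cut₂ ]′ c) _ _) (≡.sym (Fin.splitAt-↑ˡ m₁ i m₂)) (x₁≤i , i<y₁ , y<x)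

  -- With the first two coordinates in order, `x ≼ y` can only fail in the third, so `x` has the
  -- greater height.
  cut₂-separates : ∀ {x₁ x₂ x₃ y₁ y₂ y₃} →
    ¬ (x₁ ∷ x₂ ∷ x₃ ∷ []) ≼ (y₁ ∷ y₂ ∷ y₃ ∷ []) → toℕ x₁ ≤ toℕ y₁ → toℕ x₂ < toℕ y₂ →
    Separated (x₁ ∷ x₂ ∷ x₃ ∷ []) (y₁ ∷ y₂ ∷ y₃ ∷ [])
  cut₂-separates {x₂ = x₂} {y₂ = y₂} x⋠y x₁≤y₁ x₂<y₂ with threshold-between x₂ y₂ x₂<y₂
  ... | j , x₂≤j , j<y₂ = m₁ ↑ʳ j ,
    subst (λ c → Separates ([ cut₁ , cut₂ ]′ c) _ _) (≡.sym (Fin.splitAt-↑ʳ m₁ m₂ j))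
      (x₂≤j , j<y₂ , ℕ.≰⇒> (λ x₃≤y₃ → x⋠y (x₁≤y₁ ∷ ℕ.<⇒≤ x₂<y₂ ∷ x₃≤y₃ ∷ [])))

  -- If `x₂ < y₂`, the second coordinate provides the cut. Otherwise `x` is lexicographically
  -- higher, a tie in the second coordinate being broken by the third.
  separates : ∀ x y → ¬ x ≼ y → toℕ (All.head x) < toℕ (All.head y) → Separated x y
  separates (x₁ ∷ x₂ ∷ x₃ ∷ []) (y₁ ∷ y₂ ∷ y₃ ∷ []) x⋠y x₁<y₁ with Fin.<-cmp x₂ y₂
  ... | tri< x₂<y₂ _ _ = cut₂-separates x⋠y (ℕ.<⇒≤ x₁<y₁) x₂<y₂
  ... | tri≈ _ refl _ = cut₁-separates x₁<y₁ (combine-monoʳ-< x₂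
    (ℕ.≰⇒> (λ x₃≤y₃ → x⋠y (ℕ.<⇒≤ x₁<y₁ ∷ ℕ.≤-refl ∷ x₃≤y₃ ∷ []))))
  ... | tri> _ _ y₂<x₂ = cut₁-separates x₁<y₁ (Fin.combine-monoˡ-< y₃ x₃ y₂<x₂)

  separating : ∀ x y → ¬ x ≼ y → ¬ y ≼ x → ∃ λ i → Separates (cut i) x y ⊎ Separates (cut i) y x
  separating x@(x₁ ∷ x₂ ∷ x₃ ∷ []) y@(y₁ ∷ y₂ ∷ y₃ ∷ []) x⋠y y⋠x
    with Fin.<-cmp x₁ y₁ | Fin.<-cmp x₂ y₂
  ... | tri< x₁<y₁ _ _ | _ = Product.map₂ inj₁ (separates x y x⋠y x₁<y₁)
  ... | tri> _ _ y₁<x₁ | _ = Product.map₂ inj₂ (separates y x y⋠x y₁<x₁)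
  ... | tri≈ _ refl _ | tri< x₂<y₂ _ _ = Product.map₂ inj₁ (cut₂-separates x⋠y ℕ.≤-refl x₂<y₂)
  ... | tri≈ _ refl _ | tri> _ _ y₂<x₂ = Product.map₂ inj₂ (cut₂-separates y⋠x ℕ.≤-refl y₂<x₂)
  ... | tri≈ _ refl _ | tri≈ _ refl _ = contradiction (Fin.≤-total x₃ y₃)
    [ (λ p → x⋠y (ℕ.≤-refl ∷ ℕ.≤-refl ∷ p ∷ []))
    , (λ p → y⋠x (ℕ.≤-refl ∷ ℕ.≤-refl ∷ p ∷ [])) ]′

-- Lower bound

≼-refl : ∀ {s} {a : Vec ℕ s} (x : Tuple a) → x ≼ x
≼-refl x = Pointwise.refl ℕ.≤-refl

≼-trans : ∀ {s} {a : Vec ℕ s} (x y z : Tuple a) → x ≼ y → y ≼ z → x ≼ z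
≼-trans x y z = Pointwise.trans ℕ.≤-trans

infix 4 _∥_

_∥_ : ∀ {s} {a : Vec ℕ s} → Tuple a → Tuple a → Set
x ∥ y = ¬ x ≼ y × ¬ y ≼ x

-- Coordinates of a box representation that split sets of vertices.

module Coordinates {s} {a : Vec ℕ s} {k} (f : Tuple a → Box k) (rep : IsBoxRep (TCC a) f) where

  open RawMonad (¬¬-Monad {a = 0ℓ}) using (_>>=_; pure; rawApplicative)

  _≟_ : DecidableEquality (Tuple a)
  _≟_ = Fin.inj⇒≟ (↔⇒↣ (proj₂ (Tuple-finite a)))

  -- The representation constrains only distinct vertices; for equal ones an interval overlaps
  -- itself.
  ≼⇒overlap : ∀ u v → u ≼ v → ∀ c → Overlap (f u c) (f v c)
  ≼⇒overlap u v u≼v c with u ≟ v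
  ... | yes refl = lo≤hi (f u c) , lo≤hi (f u c)
  ... | no u≢v = to (intersect⇔overlap (f u) (f v)) (to (rep u v u≢v) (u≢v , inj₁ u≼v)) c

  Apart : Fin k → Tuple a → Tuple a → Set
  Apart c u v = f u c ⊲ f v c ⊎ f v c ⊲ f u c

  -- If no coordinate separates, each one overlaps up to double negation. Finiteness of `Fin k`
  -- moves the double negation outside, and the boxes then meet.
  ∥⇒apart : ∀ u v → u ∥ v → ¬ ¬ ∃ λ c → Apart c u v
  ∥⇒apart u v (u⋠v , v⋠u) none = Fin.sequence rawApplicative overlapping λ o →
    [ u⋠v , v⋠u ]′ (proj₂ (from (rep u v u≢v) (from (intersect⇔overlap (f u) (f v)) o)))
    where
    u≢v : u ≢ v
    u≢v refl = u⋠v (≼-refl u)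

    overlapping : ∀ c → ¬ ¬ Overlap (f u c) (f v c)
    overlapping c ¬o = none (c , inj₁ λ p → none (c , inj₂ λ q → ¬o (q , p)))

  Splits : Fin k → (Tuple a → Set) → Set
  Splits c P = ∃ λ u → ∃ λ v → P u × P v × f u c ⊲ f v c

  apart⇒splits : ∀ {c u v} {P : Tuple a → Set} → P u → P v → Apart c u v → Splits c P
  apart⇒splits Pu Pv (inj₁ u⊲v) = _ , _ , Pu , Pv , u⊲v
  apart⇒splits Pu Pv (inj₂ v⊲u) = _ , _ , Pv , Pu , v⊲u

  splits-map : ∀ {c} {P Q : Tuple a → Set} → (∀ {x} → P x → Q x) → Splits c P → Splits c Q
  splits-map P⊆Q (u , v , Pu , Pv , u⊲v) = u , v , P⊆Q Pu , P⊆Q Pv , u⊲v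

  -- Every vertex below `t` is comparable to every vertex above it, so the two splits would form a
  -- 2+2.
  no-split-both-sides : ∀ {c} t → Splits c (_≼ t) → ¬ Splits c (t ≼_)
  no-split-both-sides {c} t (u , v , u≼t , v≼t , u⊲v) (u′ , v′ , t≼u′ , t≼v′ , u′⊲v′) =
    no-2+2 (f u c) (f v c) (f u′ c) (f v′ c) u⊲v u′⊲v′
      (≼⇒overlap u v′ (≼-trans u t v′ u≼t t≼v′) c)
      (swap (≼⇒overlap v u′ (≼-trans v t u′ v≼t t≼u′) c))

  -- At least n coordinates split the vertices below t; doubly negated because the
  -- order of ℝ is undecidable.
  SplitBelow : ℕ → Tuple a → Set
  SplitBelow n t = ¬ ¬ ∃ λ (cs : Vec (Fin k) n) → Unique cs × All (λ c → Splits c (_≼ t)) cs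

  splitBelow-0 : ∀ {t} → SplitBelow 0 t
  splitBelow-0 = pure ([] , [] , [])

  -- Distinct coordinates inject `Fin n` into `Fin k`; decidability of `≤` on ℕ removes the double
  -- negation.
  splitBelow⇒≤ : ∀ {n t} → SplitBelow n t → n ≤ k
  splitBelow⇒≤ {n} split = decidable-stable (n ℕ.≤? k)
    (¬¬-map (λ (cs , unique , _) → Fin.injective⇒≤ (λ {i} {j} → lookup-injective unique i j)) split)

  fresh : ∀ {n c t} {cs : Vec (Fin k) n} → Splits c (t ≼_) → All (λ d → Splits d (_≼ t)) cs → All (c ≢_) cs
  fresh {t = t} above = All.map λ { below refl → no-split-both-sides t below above }

  module _ {t t′ : Tuple a} where

    Between : Tuple a → Set
    Between x = t ≼ x × x ≼ t′

    raise : ∀ {n} {cs : Vec (Fin k) n} → t ≼ t′ →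
      All (λ c → Splits c (_≼ t)) cs → All (λ c → Splits c (_≼ t′)) cs
    raise t≼t′ = All.map (splits-map λ {x} x≼t → ≼-trans x t t′ x≼t t≼t′)

    pair-step : ∀ {n} u v → Between u → Between v → u ∥ v → SplitBelow n t → SplitBelow (1 + n) t′
    pair-step u v (t≼u , u≼t′) (t≼v , v≼t′) u∥v split = do
      cs , unique , below ← split
      c , apart ← ∥⇒apart u v u∥v
      pure (c ∷ cs ,
        fresh (apart⇒splits t≼u t≼v apart) below ∷ unique ,
        apart⇒splits u≼t′ v≼t′ apart ∷ raise (≼-trans t u t′ t≼u u≼t′) below)

    -- Two of the three pairs would be split in the same direction.
    no-crown-split : ∀ {c} (u v : Fin 3 → Tuple a) → (∀ i j → i ≢ j → u i ≼ v j) →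
      ¬ (∀ i → Apart c (u i) (v i))
    no-crown-split {c} u v u≼v apart = cases (apart 0F) (apart 1F) (apart 2F)
      where
      0F 1F 2F : Fin 3
      0F = zero
      1F = suc zero
      2F = suc (suc zero)

      up : ∀ i j → i ≢ j → f (u i) c ⊲ f (v i) c → ¬ f (u j) c ⊲ f (v j) c
      up i j i≢j p q = no-2+2 (f (u i) c) (f (v i) c) (f (u j) c) (f (v j) c) p q
        (≼⇒overlap (u i) (v j) (u≼v i j i≢j) c) (≼⇒overlap (u j) (v i) (u≼v j i (i≢j ∘ ≡.sym)) c)

      down : ∀ i j → i ≢ j → f (v i) c ⊲ f (u i) c → ¬ f (v j) c ⊲ f (u j) c
      down i j i≢j p q = no-2+2 (f (v i) c) (f (u i) c) (f (v j) c) (f (u j) c) p q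
        (swap (≼⇒overlap (u j) (v i) (u≼v j i (i≢j ∘ ≡.sym)) c)) (swap (≼⇒overlap (u i) (v j) (u≼v i j i≢j) c))

      cases : Apart c (u 0F) (v 0F) → Apart c (u 1F) (v 1F) → ¬ Apart c (u 2F) (v 2F)
      cases (inj₁ p) (inj₁ q) _        = up 0F 1F (λ ()) p q
      cases (inj₂ p) (inj₂ q) _        = down 0F 1F (λ ()) p q
      cases (inj₁ p) (inj₂ q) (inj₁ r) = up 0F 2F (λ ()) p r
      cases (inj₁ p) (inj₂ q) (inj₂ r) = down 1F 2F (λ ()) q r
      cases (inj₂ p) (inj₁ q) (inj₁ r) = up 1F 2F (λ ()) q r
      cases (inj₂ p) (inj₁ q) (inj₂ r) = down 0F 2F (λ ()) p r

    -- Each of the three pairs is separated by some coordinate. These three are not all equal, and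
    -- any two different ones are also new, since they split vertices above `t`.
    crown-step : ∀ {n} (u v : Fin 3 → Tuple a) → (∀ i → Between (u i)) → (∀ i → Between (v i)) →
      (∀ i → u i ∥ v i) → (∀ i j → i ≢ j → u i ≼ v j) → SplitBelow n t → SplitBelow (2 + n) t′
    crown-step u v tut′ tvt′ u∥v u≼v split = do
      cs , unique , below ← split
      apart ← Fin.sequence rawApplicative (λ i → ∥⇒apart (u i) (v i) (u∥v i))
      let c i  = proj₁ (apart i)
          above i = apart⇒splits (proj₁ (tut′ i)) (proj₁ (tvt′ i)) (proj₂ (apart i))
          below′ i = apart⇒splits (proj₂ (tut′ i)) (proj₂ (tvt′ i)) (proj₂ (apart i))
          i , j , ci≢cj = distinct c (proj₂ ∘ apart)
      pure (c i ∷ c j ∷ cs ,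
        (ci≢cj ∷ fresh (above i) below) ∷ fresh (above j) below ∷ unique ,
        below′ i ∷ below′ j ∷ raise (≼-trans t (u i) t′ (proj₁ (tut′ i)) (proj₂ (tut′ i))) below)
      where
      distinct : (c : Fin 3 → Fin k) → (∀ i → Apart (c i) (u i) (v i)) → ∃ λ i → ∃ λ j → c i ≢ c j
      distinct c apart with c zero Fin.≟ c (suc zero) | c zero Fin.≟ c (suc (suc zero))
      ... | no c₀≢c₁ | _ = zero , suc zero , c₀≢c₁
      ... | _ | no c₀≢c₂ = zero , suc (suc zero) , c₀≢c₂
      ... | yes c₀≡c₁ | yes c₀≡c₂ = contradiction
        (λ { zero → apart zero
           ; (suc zero) → subst (λ d → Apart d _ _) (≡.sym c₀≡c₁) (apart (suc zero))
           ; (suc (suc zero)) → subst (λ d → Apart d _ _) (≡.sym c₀≡c₂) (apart (suc (suc zero))) })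
        (no-crown-split u v u≼v)

-- Chains of blocks in two and three coordinates.

at : ∀ {m} i → .(i ≤ m) → Fin (suc m)
at i i≤m = fromℕ< (s≤s i≤m)

at-< : ∀ {m i j} .(i≤m : i ≤ m) .(j≤m : j ≤ m) → i < j → toℕ (at i i≤m) < toℕ (at j j≤m)
at-< i≤m j≤m i<j rewrite Fin.toℕ-fromℕ< (s≤s i≤m) | Fin.toℕ-fromℕ< (s≤s j≤m) = i<j

-- The chain climbs the diagonal from `(0, 0)` to `(m₁, m₁)`; between `(n, n)` and `(n + 1, n + 1)`
-- lies the antichain of the two mixed corners.
boxicity-lower₂ : ∀ m₁ m₂ → m₁ ≤ m₂ → ∀ k → HasBoxRep (TCC (m₁ ∷ m₂ ∷ [])) k → m₁ ≤ k
boxicity-lower₂ m₁ m₂ m₁≤m₂ k (f , rep) = splitBelow⇒≤ (chain m₁ ℕ.≤-refl m₁≤m₂)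
  where
  open Coordinates f rep

  chain : ∀ n (n≤m₁ : n ≤ m₁) (n≤m₂ : n ≤ m₂) → SplitBelow n (at n n≤m₁ ∷ at n n≤m₂ ∷ [])
  chain zero    _    _    = splitBelow-0
  chain (suc n) n<m₁ n<m₂ = pair-step
    (at n n≤m₁ ∷ at (suc n) n<m₂ ∷ []) (at (suc n) n<m₁ ∷ at n n≤m₂ ∷ [])
    (ℕ.≤-refl ∷ ℕ.<⇒≤ lt₂ ∷ [] , ℕ.<⇒≤ lt₁ ∷ ℕ.≤-refl ∷ [])
    (ℕ.<⇒≤ lt₁ ∷ ℕ.≤-refl ∷ [] , ℕ.≤-refl ∷ ℕ.<⇒≤ lt₂ ∷ [])
    ((λ { (_ ∷ p ∷ _) → ℕ.<⇒≱ lt₂ p }) , (λ { (p ∷ _) → ℕ.<⇒≱ lt₁ p }))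
    (chain n n≤m₁ n≤m₂)
    where
    n≤m₁ = ℕ.<⇒≤ n<m₁
    n≤m₂ = ℕ.<⇒≤ n<m₂
    lt₁ = at-< n≤m₁ n<m₁ (ℕ.n<1+n n)
    lt₂ = at-< n≤m₂ n<m₂ (ℕ.n<1+n n)

boxicity-lower₃ : ∀ m₁ m₂ m₃ → m₁ ≤ m₂ → m₂ ≤ m₃ → ∀ k →
  HasBoxRep (TCC (m₁ ∷ m₂ ∷ m₃ ∷ [])) k → m₁ + m₂ ≤ k
boxicity-lower₃ m₁ m₂ m₃ m₁≤m₂ m₂≤m₃ k (f , rep) =
  subst (_≤ k) total (splitBelow⇒≤ (pairs₂₃ (m₂ ∸ t) p+t≤m₁ q+t≤m₂ q+p+t≤m₃))
  where
  open Coordinates f rep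

  crown : ∀ {n l₁ h₁ l₂ h₂ l₃ h₃} → toℕ l₁ < toℕ h₁ → toℕ l₂ < toℕ h₂ → toℕ l₃ < toℕ h₃ →
    SplitBelow n (l₁ ∷ l₂ ∷ l₃ ∷ []) → SplitBelow (2 + n) (h₁ ∷ h₂ ∷ h₃ ∷ [])
  crown {l₁ = l₁} {h₁} {l₂} {h₂} {l₃} {h₃} lt₁ lt₂ lt₃ = crown-step
    -- Atom `i` is raised only at coordinate `i` and coatom `i` is lowered only there: they are
    -- complementary, while atom `i` lies below every other coatom.
    (λ { zero             → h₁ ∷ l₂ ∷ l₃ ∷ []
       ; (suc zero)       → l₁ ∷ h₂ ∷ l₃ ∷ []
       ; (suc (suc zero)) → l₁ ∷ l₂ ∷ h₃ ∷ [] })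
    (λ { zero             → l₁ ∷ h₂ ∷ h₃ ∷ []
       ; (suc zero)       → h₁ ∷ l₂ ∷ h₃ ∷ []
       ; (suc (suc zero)) → h₁ ∷ h₂ ∷ l₃ ∷ [] })
    (λ { zero             → s₁ ∷ r ∷ r ∷ [] , r ∷ s₂ ∷ s₃ ∷ []
       ; (suc zero)       → r ∷ s₂ ∷ r ∷ [] , s₁ ∷ r ∷ s₃ ∷ []
       ; (suc (suc zero)) → r ∷ r ∷ s₃ ∷ [] , s₁ ∷ s₂ ∷ r ∷ [] })
    (λ { zero             → r ∷ s₂ ∷ s₃ ∷ [] , s₁ ∷ r ∷ r ∷ []
       ; (suc zero)       → s₁ ∷ r ∷ s₃ ∷ [] , r ∷ s₂ ∷ r ∷ []
       ; (suc (suc zero)) → s₁ ∷ s₂ ∷ r ∷ [] , r ∷ r ∷ s₃ ∷ [] })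
    (λ { zero             → (λ { (p ∷ _) → n₁ p }) , (λ { (_ ∷ p ∷ _) → n₂ p })
       ; (suc zero)       → (λ { (_ ∷ p ∷ _) → n₂ p }) , (λ { (p ∷ _) → n₁ p })
       ; (suc (suc zero)) → (λ { (_ ∷ _ ∷ p ∷ _) → n₃ p }) , (λ { (p ∷ _) → n₁ p }) })
    (λ { zero             zero             i≢i → contradiction refl i≢i
       ; zero             (suc zero)       _   → r ∷ r ∷ s₃ ∷ []
       ; zero             (suc (suc zero)) _   → r ∷ s₂ ∷ r ∷ []
       ; (suc zero)       zero             _   → r ∷ r ∷ s₃ ∷ []
       ; (suc zero)       (suc zero)       i≢i → contradiction refl i≢i
       ; (suc zero)       (suc (suc zero)) _   → s₁ ∷ r ∷ r ∷ []
       ; (suc (suc zero)) zero             _   → r ∷ s₂ ∷ r ∷ []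
       ; (suc (suc zero)) (suc zero)       _   → s₁ ∷ r ∷ r ∷ []
       ; (suc (suc zero)) (suc (suc zero)) i≢i → contradiction refl i≢i })
    where
    r : ∀ {n} → n ≤ n
    r = ℕ.≤-refl
    s₁ = ℕ.<⇒≤ lt₁
    s₂ = ℕ.<⇒≤ lt₂
    s₃ = ℕ.<⇒≤ lt₃
    n₁ = ℕ.<⇒≱ lt₁
    n₂ = ℕ.<⇒≱ lt₂
    n₃ = ℕ.<⇒≱ lt₃

  pair₁₃ : ∀ {n l₁ h₁ x l₃ h₃} → toℕ l₁ < toℕ h₁ → toℕ l₃ < toℕ h₃ →
    SplitBelow n (l₁ ∷ x ∷ l₃ ∷ []) → SplitBelow (1 + n) (h₁ ∷ x ∷ h₃ ∷ [])
  pair₁₃ {l₁ = l₁} {h₁} {x} {l₃} {h₃} lt₁ lt₃ = pair-step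
    (h₁ ∷ x ∷ l₃ ∷ []) (l₁ ∷ x ∷ h₃ ∷ [])
    (ℕ.<⇒≤ lt₁ ∷ ℕ.≤-refl ∷ ℕ.≤-refl ∷ [] , ℕ.≤-refl ∷ ℕ.≤-refl ∷ ℕ.<⇒≤ lt₃ ∷ [])
    (ℕ.≤-refl ∷ ℕ.≤-refl ∷ ℕ.<⇒≤ lt₃ ∷ [] , ℕ.<⇒≤ lt₁ ∷ ℕ.≤-refl ∷ ℕ.≤-refl ∷ [])
    ((λ { (p ∷ _) → ℕ.<⇒≱ lt₁ p }) , (λ { (_ ∷ _ ∷ p ∷ _) → ℕ.<⇒≱ lt₃ p }))

  pair₂₃ : ∀ {n x l₂ h₂ l₃ h₃} → toℕ l₂ < toℕ h₂ → toℕ l₃ < toℕ h₃ →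
    SplitBelow n (x ∷ l₂ ∷ l₃ ∷ []) → SplitBelow (1 + n) (x ∷ h₂ ∷ h₃ ∷ [])
  pair₂₃ {x = x} {l₂} {h₂} {l₃} {h₃} lt₂ lt₃ = pair-step
    (x ∷ h₂ ∷ l₃ ∷ []) (x ∷ l₂ ∷ h₃ ∷ [])
    (ℕ.≤-refl ∷ ℕ.<⇒≤ lt₂ ∷ ℕ.≤-refl ∷ [] , ℕ.≤-refl ∷ ℕ.≤-refl ∷ ℕ.<⇒≤ lt₃ ∷ [])
    (ℕ.≤-refl ∷ ℕ.≤-refl ∷ ℕ.<⇒≤ lt₃ ∷ [] , ℕ.≤-refl ∷ ℕ.<⇒≤ lt₂ ∷ ℕ.≤-refl ∷ [])
    ((λ { (_ ∷ p ∷ _) → ℕ.<⇒≱ lt₂ p }) , (λ { (_ ∷ _ ∷ p ∷ _) → ℕ.<⇒≱ lt₃ p }))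

  next : ∀ {m} i (i<m : i < m) → toℕ (at i (ℕ.<⇒≤ i<m)) < toℕ (at (suc i) i<m)
  next i i<m = at-< (ℕ.<⇒≤ i<m) i<m (ℕ.n<1+n i)

  -- Each crown moves one step along the diagonal and gains two coordinates.
  crowns : ∀ t (t≤m₁ : t ≤ m₁) (t≤m₂ : t ≤ m₂) (t≤m₃ : t ≤ m₃) →
    SplitBelow (t * 2) (at t t≤m₁ ∷ at t t≤m₂ ∷ at t t≤m₃ ∷ [])
  crowns zero    _ _ _ = splitBelow-0
  crowns (suc t) t<m₁ t<m₂ t<m₃ = crown (next t t<m₁) (next t t<m₂) (next t t<m₃)
    (crowns t (ℕ.<⇒≤ t<m₁) (ℕ.<⇒≤ t<m₂) (ℕ.<⇒≤ t<m₃))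

  -- The number of crowns is chosen so that the third coordinate just suffices.
  t = (m₁ + m₂) ∸ m₃

  -- This is where `m₂ ≤ m₃` enters.
  t≤m₁ : t ≤ m₁
  t≤m₁ = ℕ.m≤n+o⇒m∸n≤o (m₁ + m₂) m₃ (ℕ.≤-trans (ℕ.+-monoʳ-≤ m₁ m₂≤m₃) (ℕ.≤-reflexive (ℕ.+-comm m₁ m₃)))

  t≤m₂ : t ≤ m₂
  t≤m₂ = ℕ.≤-trans t≤m₁ m₁≤m₂

  -- Climbs from `(t, t, t)` with the second coordinate fixed; at `p = m₁ ∸ t` the first coordinate
  -- reaches `m₁`.
  pairs₁₃ : ∀ p (p+t≤m₁ : p + t ≤ m₁) (p+t≤m₃ : p + t ≤ m₃) →
    SplitBelow (p + t * 2) (at (p + t) p+t≤m₁ ∷ at t t≤m₂ ∷ at (p + t) p+t≤m₃ ∷ [])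
  pairs₁₃ zero    t≤m₁ t≤m₃ = crowns t t≤m₁ t≤m₂ t≤m₃
  pairs₁₃ (suc p) <m₁  <m₃  = pair₁₃ (next (p + t) <m₁) (next (p + t) <m₃)
    (pairs₁₃ p (ℕ.<⇒≤ <m₁) (ℕ.<⇒≤ <m₃))

  p = m₁ ∸ t

  p+t≤m₁ : p + t ≤ m₁
  p+t≤m₁ = ℕ.≤-reflexive (ℕ.m∸n+n≡m t≤m₁)

  q+t≤m₂ : m₂ ∸ t + t ≤ m₂
  q+t≤m₂ = ℕ.≤-reflexive (ℕ.m∸n+n≡m t≤m₂)

  pairs₂₃ : ∀ q (≤m₁ : p + t ≤ m₁) (≤m₂ : q + t ≤ m₂) (≤m₃ : q + (p + t) ≤ m₃) →
    SplitBelow (q + (p + t * 2)) (at (p + t) ≤m₁ ∷ at (q + t) ≤m₂ ∷ at (q + (p + t)) ≤m₃ ∷ [])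
  -- The bound in `at` is irrelevant, so the discarded proof and `t≤m₂` give the same tuple.
  pairs₂₃ zero    ≤m₁ _   ≤m₃ = pairs₁₃ p ≤m₁ ≤m₃
  pairs₂₃ (suc q) ≤m₁ <m₂ <m₃ = pair₂₃ (next (q + t) <m₂) (next (q + (p + t)) <m₃)
    (pairs₂₃ q ≤m₁ (ℕ.<⇒≤ <m₂) (ℕ.<⇒≤ <m₃))

  q+p+t≤m₃ : m₂ ∸ t + (p + t) ≤ m₃
  q+p+t≤m₃ = begin
    m₂ ∸ t + (p + t)      ≡⟨ cong (m₂ ∸ t +_) (ℕ.m∸n+n≡m t≤m₁) ⟩
    m₂ ∸ t + m₁           ≡⟨ ℕ.+-comm (m₂ ∸ t) m₁ ⟩
    m₁ + (m₂ ∸ t)         ≡⟨ ℕ.+-∸-assoc m₁ t≤m₂ ⟨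
    -- By the choice of `t`, `m₁ + m₂ ≤ m₃ + t`, also when the subtraction truncates to 0.
    (m₁ + m₂) ∸ t         ≤⟨ ℕ.m≤n+o⇒m∸n≤o (m₁ + m₂) t (ℕ.≤-trans (ℕ.m≤n+m∸n (m₁ + m₂) m₃) (ℕ.≤-reflexive (ℕ.+-comm m₃ t))) ⟩
    m₃                    ∎
    where open ℕ.≤-Reasoning

  total : m₂ ∸ t + (p + t * 2) ≡ m₁ + m₂
  total = begin
    m₂ ∸ t + (p + t * 2)      ≡⟨ solve 3 (λ x y z → x :+ (y :+ z :* con 2) := (y :+ z) :+ (x :+ z)) refl (m₂ ∸ t) p t ⟩
    (p + t) + (m₂ ∸ t + t)    ≡⟨ ≡.cong₂ _+_ (ℕ.m∸n+n≡m t≤m₁) (ℕ.m∸n+n≡m t≤m₂) ⟩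
    m₁ + m₂                   ∎
    where
    open ≡.≡-Reasoning
    open +-*-Solver

-- A cube representation is a box representation, so one construction and one lower bound settle
-- both invariants.
least : ∀ Γ n → HasCubeRep Γ n → (∀ k → HasBoxRep Γ k → n ≤ k) → IsBoxicity Γ n × IsCubicity Γ n
least Γ n cubes@(f , rep) lower =
  ((proj₁ ∘ f , rep) , lower) , (cubes , λ k (g , rep′) → lower k (proj₁ ∘ g , rep′))

corollary2 : (m₁ m₂ m₃ : ℕ) → 1 ≤ m₁ → m₁ ≤ m₂ → m₂ ≤ m₃ →
    (IsBoxicity (TCC (m₁ ∷ [])) 0 × IsCubicity (TCC (m₁ ∷ [])) 0)
    × (IsBoxicity (TCC (m₁ ∷ m₂ ∷ [])) m₁ × IsCubicity (TCC (m₁ ∷ m₂ ∷ [])) m₁)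
    × (IsBoxicity (TCC (m₁ ∷ m₂ ∷ m₃ ∷ [])) (m₁ + m₂) × IsCubicity (TCC (m₁ ∷ m₂ ∷ m₃ ∷ [])) (m₁ + m₂))
corollary2 m₁ m₂ m₃ _ m₁≤m₂ m₂≤m₃ =
  least (TCC (m₁ ∷ [])) 0 (cubeRep₁ m₁) (λ _ _ → z≤n) ,
  least (TCC (m₁ ∷ m₂ ∷ [])) m₁ (cubeRep₂ m₁ m₂) (boxicity-lower₂ m₁ m₂ m₁≤m₂) ,
  least (TCC (m₁ ∷ m₂ ∷ m₃ ∷ [])) (m₁ + m₂) (cubeRep₃ m₁ m₂ m₃) (boxicity-lower₃ m₁ m₂ m₃ m₁≤m₂ m₂≤m₃)
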